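{- Let $m\ge 2$ be an integer and let $n$ be a positive integer with $m^j\le n<m^{j+1}$ for some integer $j\ge 0$, with base $m$ representation $n=\alpha_j m^j+\cdots+\alpha_1 m+\alpha_0$ ($\alpha_j>0$, $0\le\alpha_i\le m-1$). Then the number $b_m(n)$ of $m$-ary partitions of $n$ satisfies \[ b_m(n)=\sum_{k_j=0}^{\alpha_j}\ \sum_{k_{j-1}=0}^{\alpha_{j-1}+mk_j}\cdots\sum_{k_1=0}^{\alpha_1+mk_2}1, \] i.e. $b_m(n)$ is the number of integer tuples $(k_j,\ldots,k_1)$ with $0\le k_j\le\alpha_j$ and $0\le k_t\le \alpha_t+mk_{t+1}$ for $1\le t\le j-1$. In particular $b_m(n)=1$ when $j=0$.
   Context: An $m$-ary partition of a positive integer $n$ is a partition of $n$ in which every part is a power of $m$ (i.e. one of $1,m,m^2,\ldots$). $b_m(n)$ denotes the number of $m$-ary partitions of $n$. -}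

module Defs where

open import Data.List.Base using (List; length; map; upTo)
open import Data.List.Membership.Propositional using (_∈_)
open import Data.List.Membership.Propositional.Properties.WithK using (unique∧set⇒bag)
open import Data.List.Relation.Binary.BagAndSetEquality using (∼bag⇒↭)
open import Data.List.Relation.Binary.Permutation.Propositional.Properties using (↭-length)
open import Data.List.Relation.Unary.All using (All)
open import Data.List.Relation.Unary.Linked using (Linked)
open import Data.List.Relation.Unary.Unique.Propositional using (Unique)
open import Data.Nat.Base using (ℕ; zero; suc; _+_; _*_; _∸_; _^_; _≤_; _<_; _≥_)
open import Data.Nat.ListAction using (sum)
open import Data.Product.Base using (∃-syntax; _×_; _,_)
open import Data.Unit.Base using (⊤)
open import Data.Vec.Base using (Vec; []; _∷_)
open import Function.Bundles using (_⇔_)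
open import Function.Construct.Composition using (_⇔-∘_)
open import Function.Construct.Symmetry using (⇔-sym)
open import Relation.Binary.PropositionalEquality using (_≡_; refl)

-- Exactly c elements satisfy P: some duplicate-free list of length c contains
-- precisely these elements.  Counting elements of A rather than inhabitants of
-- ∃ P makes the count independent of how many proofs P x has.
NumberOf : {A : Set} → (A → Set) → ℕ → Set
NumberOf {A} P c =
  ∃[ xs ] Unique xs × (∀ (x : A) → x ∈ xs ⇔ P x) × length xs ≡ c

NumberOf-unique : {A : Set} {P : A → Set} {c d : ℕ} →
                  NumberOf P c → NumberOf P d → c ≡ d
NumberOf-unique (xs , xs! , xs⇔P , refl) (ys , ys! , ys⇔P , refl) =
  ↭-length (∼bag⇒↭ (unique∧set⇒bag xs! ys!
    (λ {x} → ⇔-sym (ys⇔P x) ⇔-∘ xs⇔P x)))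

-- A partition is represented by the weakly decreasing list of its parts.
record IsPartition (n : ℕ) (ps : List ℕ) : Set where
  field
    decreasing : Linked _≥_ ps
    positive   : All (0 <_) ps
    total      : sum ps ≡ n

IsPowerOf : ℕ → ℕ → Set
IsPowerOf m p = ∃[ i ] p ≡ m ^ i

IsMAryPartition : (m n : ℕ) → List ℕ → Set
IsMAryPartition m n ps = IsPartition n ps × All (IsPowerOf m) ps

-- The upper bound is inclusive: upTo (suc b) lists 0, …, b.
∑≤ : ℕ → (ℕ → ℕ) → ℕ
∑≤ b f = sum (map f (upTo (suc b)))

syntax ∑≤ b (λ k → e) = ∑[ k ≤ b ] e

-- n = α j · m ^ j + ⋯ + α 1 · m + α 0; the values of α above j play no role,
-- here and below.
record IsBaseRepresentation (m j : ℕ) (α : ℕ → ℕ) (n : ℕ) : Set where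
  field
    leading : 0 < α j
    digits  : ∀ i → i ≤ j → α i ≤ m ∸ 1
    value   : n ≡ ∑[ i ≤ j ] (α i * m ^ i)

module _ (m : ℕ) (α : ℕ → ℕ) where

  -- The sums over k_t, …, k_1, where K is the value of k_{t+1}.
  innerSum : (t K : ℕ) → ℕ
  innerSum zero    K = 1
  innerSum (suc t) K = ∑[ k ≤ α (suc t) + m * K ] innerSum t k

  -- The sums over k_j, …, k_1; the bound for k_j is α j alone.
  nestedSum : (j : ℕ) → ℕ
  nestedSum zero    = 1
  nestedSum (suc t) = ∑[ k ≤ α (suc t) ] innerSum t k

  -- Vectors of length t list k_t, …, k_1 in this order; K is again k_{t+1}.
  InnerBounds : {t : ℕ} → ℕ → Vec ℕ t → Set
  InnerBounds             K []       = ⊤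
  InnerBounds {t = suc t} K (k ∷ ks) = k ≤ α (suc t) + m * K × InnerBounds k ks

  Bounds : {j : ℕ} → Vec ℕ j → Set
  Bounds             []       = ⊤
  Bounds {j = suc t} (k ∷ ks) = k ≤ α (suc t) × InnerBounds k ks

{-# OPTIONS --safe #-}

-- Fill in the parts m ^ j, m ^ (j - 1), … of an m-ary partition of n from the
-- largest down, and let k_t be such that k_t · m ^ t + α_{t-1} · m ^ (t-1) + ⋯ + α_0
-- is what the parts below m ^ t have to add up to.  Since the lower digits add
-- up to less than m ^ t, the parts m ^ t can use up any amount of the available
-- α_t + m · k_{t+1} copies (with k_{j+1} = 0) and nothing else, which is
-- 0 ≤ k_t ≤ α_t + m · k_{t+1}; at the end, the remaining α_0 + m · k_1 is made
-- of ones.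

module Submission where

open import Defs
open import Data.Empty using (⊥)
open import Data.List.Base
  using (List; []; _∷_; _++_; length; map; concatMap; replicate; upTo; [_])
open import Data.List.Membership.Propositional using (_∈_; lose; find)
open import Data.List.Membership.Propositional.Properties
  using (∈-map⁺; ∈-map⁻; ∈-concatMap⁺; ∈-concatMap⁻; ∈-upTo⁺; ∈-upTo⁻)
open import Data.List.Properties
  using (length-map; length-++; ++-identityʳ; map-++; upTo-∷ʳ; ∷-injective)
open import Data.List.Relation.Unary.All using (All; []; _∷_; universal)
import Data.List.Relation.Unary.All as All
import Data.List.Relation.Unary.All.Properties as All
open import Data.List.Relation.Unary.AllPairs using (AllPairs; []; _∷_)
import Data.List.Relation.Unary.AllPairs as AllPairs
import Data.List.Relation.Unary.AllPairs.Properties as AllPairs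
open import Data.List.Relation.Unary.Any using (here; there)
open import Data.List.Relation.Unary.Linked.Properties using (Linked⇒AllPairs; AllPairs⇒Linked)
open import Data.List.Relation.Unary.Unique.Propositional using (Unique)
import Data.List.Relation.Unary.Unique.Propositional.Properties as Unique
open import Data.Nat.Base
open import Data.Nat.ListAction using (sum)
open import Data.Nat.ListAction.Properties using (sum-++)
open import Data.Nat.Properties
open import Data.Nat.Tactic.RingSolver using (solve-∀)
open import Data.Product.Base using (∃-syntax; _×_; _,_; proj₁; proj₂)
open import Data.Unit.Base using (tt)
open import Data.Vec.Base using (Vec; []; _∷_)
open import Function.Base using (_∘_; id; flip)
open import Function.Bundles using (_⇔_; mk⇔; Equivalence)
open import Function.Construct.Composition using (_⇔-∘_)
open import Relation.Nullary using (yes; no; contradiction)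
open import Relation.Binary.PropositionalEquality
  using (_≡_; _≢_; refl; sym; trans; cong; cong₂; subst; module ≡-Reasoning)

open Equivalence using (to; from)

-- Counting along equivalences, injections and choices of a first entry

NumberOf-⇔ : {A : Set} {P Q : A → Set} {c : ℕ} →
             (∀ x → P x ⇔ Q x) → NumberOf P c → NumberOf Q c
NumberOf-⇔ P⇔Q (xs , xs! , xs⇔P , len) = xs , xs! , (λ x → P⇔Q x ⇔-∘ xs⇔P x) , len

-- Injectivity is asked only on members of the list: `partsBelow` will be shown injective only on
-- tuples that respect the bounds.
Unique-map-injectiveOn : {A B : Set} {f : A → B} {xs : List A} →
                         (∀ {x y} → x ∈ xs → y ∈ xs → f x ≡ f y → x ≡ y) →
                         Unique xs → Unique (map f xs)
Unique-map-injectiveOn inj []           = []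
Unique-map-injectiveOn inj (x∉xs ∷ xs!) =
  All.map⁺ (All.tabulate λ y∈xs fx≡fy →
    All.lookup x∉xs y∈xs (inj (here refl) (there y∈xs) fx≡fy))
  ∷ Unique-map-injectiveOn (λ x∈ y∈ → inj (there x∈) (there y∈)) xs!

NumberOf-image : {A B : Set} {P : A → Set} {c : ℕ} (f : A → B) →
                 (∀ {x y} → P x → P y → f x ≡ f y → x ≡ y) →
                 NumberOf P c → NumberOf (λ b → ∃[ a ] P a × f a ≡ b) c
NumberOf-image {P = P} f inj (xs , xs! , xs⇔P , len) =
  map f xs ,
  Unique-map-injectiveOn (λ x∈ y∈ → inj (to (xs⇔P _) x∈) (to (xs⇔P _) y∈)) xs! ,
  (λ b → mk⇔ image preimage) ,
  trans (length-map f xs) len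
  where
  image : ∀ {b} → b ∈ map f xs → ∃[ a ] P a × f a ≡ b
  image b∈ with a , a∈ , refl ← ∈-map⁻ f b∈ = a , to (xs⇔P a) a∈ , refl

  preimage : ∀ {b} → ∃[ a ] P a × f a ≡ b → b ∈ map f xs
  preimage (a , Pa , refl) = ∈-map⁺ f (from (xs⇔P a) Pa)

length-concatMap : {A B : Set} {f : A → ℕ} {g : A → List B} →
                   (∀ x → length (g x) ≡ f x) →
                   ∀ xs → length (concatMap g xs) ≡ sum (map f xs)
length-concatMap         len []       = refl
length-concatMap {g = g} len (x ∷ xs) =
  trans (length-++ (g x)) (cong₂ _+_ (len x) (length-concatMap len xs))

BoundedCons : {t : ℕ} → ℕ → (ℕ → Vec ℕ t → Set) → Vec ℕ (suc t) → Set
BoundedCons b P (k ∷ ks) = k ≤ b × P k ks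

-- The vectors fall into blocks by their head `k`. Different heads give disjoint blocks, so
-- concatenating the blocks repeats nothing and their lengths add up; this turns one nested range
-- into one summation sign.
NumberOf-BoundedCons : ∀ {t} b {P : ℕ → Vec ℕ t → Set} {f : ℕ → ℕ} →
                       (∀ k → NumberOf (P k) (f k)) →
                       NumberOf (BoundedCons b P) (∑≤ b f)
NumberOf-BoundedCons {t} b {P} {f} num =
  concatMap block (upTo (suc b)) ,
  Unique.concat⁺
    (All.map⁺ (universal (λ k → Unique.map⁺ (λ { refl → refl }) (proj₁ (proj₂ (num k)))) _))
    (AllPairs.map⁺ (AllPairs.map disjoint (Unique.upTo⁺ (suc b)))) ,
  (λ { (k ∷ ks) → mk⇔ sound complete }) ,
  length-concatMap {f = f} {g = block}
    (λ k → trans (length-map (k ∷_) (proj₁ (num k))) (proj₂ (proj₂ (proj₂ (num k))))) (upTo (suc b))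
  where
  block : ℕ → List (Vec ℕ (suc t))
  block k = map (k ∷_) (proj₁ (num k))

  member : ∀ k ks → ks ∈ proj₁ (num k) ⇔ P k ks
  member k = proj₁ (proj₂ (proj₂ (num k)))

  disjoint : ∀ {k l} → k ≢ l → ∀ {v} → v ∈ block k × v ∈ block l → ⊥
  disjoint k≢l (v∈k , v∈l)
    with _ , _ , refl ← ∈-map⁻ _ v∈k
    with _ , _ , refl ← ∈-map⁻ _ v∈l = k≢l refl

  sound : ∀ {k ks} → (k ∷ ks) ∈ concatMap block (upTo (suc b)) → k ≤ b × P k ks
  sound v∈
    with k , k∈ , v∈k ← find (∈-concatMap⁻ block v∈)
    with ks , ks∈ , refl ← ∈-map⁻ _ v∈k = s≤s⁻¹ (∈-upTo⁻ k∈) , to (member k ks) ks∈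

  complete : ∀ {k ks} → k ≤ b × P k ks → (k ∷ ks) ∈ concatMap block (upTo (suc b))
  complete {k} {ks} (k≤b , Pks) = ∈-concatMap⁺ block
    (lose (∈-upTo⁺ (s≤s k≤b)) (∈-map⁺ (k ∷_) (from (member k ks) Pks)))

∑≤-suc : ∀ b f → ∑≤ (suc b) f ≡ ∑≤ b f + f (suc b)
∑≤-suc b f = begin
  sum (map f (upTo (2 + b)))                   ≡⟨ cong (sum ∘ map f) (upTo-∷ʳ (suc b)) ⟨
  sum (map f (upTo (suc b) ++ [ suc b ]))      ≡⟨ cong sum (map-++ f (upTo (suc b)) _) ⟩
  sum (map f (upTo (suc b)) ++ [ f (suc b) ])  ≡⟨ sum-++ (map f (upTo (suc b))) _ ⟩
  ∑≤ b f + (f (suc b) + 0)                     ≡⟨ cong (∑≤ b f +_) (+-identityʳ _) ⟩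
  ∑≤ b f + f (suc b)                           ∎
  where open ≡-Reasoning

-- Splitting off the copies of the largest part

sum-replicate : ∀ c x → sum (replicate c x) ≡ c * x
sum-replicate zero    x = refl
sum-replicate (suc c) x = cong (x +_) (sum-replicate c x)

all-1⇒replicate : ∀ {ps} → All (_≡ 1) ps → ps ≡ replicate (sum ps) 1
all-1⇒replicate []          = refl
all-1⇒replicate (refl ∷ ps) = cong (1 ∷_) (all-1⇒replicate ps)

All-≤-sum : ∀ ps → All (_≤ sum ps) ps
All-≤-sum []       = []
All-≤-sum (p ∷ ps) = m≤m+n p _ ∷ All.map (λ q≤ → ≤-trans q≤ (m≤n+m _ p)) (All-≤-sum ps)

descending-replicate-++ : ∀ {x qs} c → All (_≤ x) qs → AllPairs _≥_ qs →
                          AllPairs _≥_ (replicate c x ++ qs)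
descending-replicate-++ zero    qs≤x qs↘ = qs↘
descending-replicate-++ (suc c) qs≤x qs↘ =
  All.++⁺ (All.replicate⁺ c ≤-refl) qs≤x ∷ descending-replicate-++ c qs≤x qs↘

-- In a descending list bounded by `x` the copies of `x` form a prefix: the first other entry is
-- strictly smaller and dominates everything after it.
split-maximum : ∀ {x ps} → AllPairs _≥_ ps → All (_≤ x) ps →
                ∃[ c ] ∃[ qs ] ps ≡ replicate c x ++ qs × AllPairs _≥_ qs × All (_< x) qs
split-maximum []         []           = 0 , [] , refl , [] , []
split-maximum {x} {p ∷ ps} (p≥ps ∷ ps↘) (p≤x ∷ ps≤x) with p ≟ x
... | yes refl with c , qs , refl , qs↘ , qs<x ← split-maximum ps↘ ps≤x =
  suc c , qs , refl , qs↘ , qs<x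
... | no p≢x = 0 , p ∷ ps , refl , p≥ps ∷ ps↘ ,
  p<x ∷ All.map (λ q≤p → ≤-<-trans q≤p p<x) p≥ps
  where p<x = ≤∧≢⇒< p≤x p≢x

-- The two prefixes must end at the same place, since an entry after the prefix cannot equal `x`.
replicate-++-injective : ∀ {x xs ys} b c → All (_< x) xs → All (_< x) ys →
                         replicate b x ++ xs ≡ replicate c x ++ ys → b ≡ c × xs ≡ ys
replicate-++-injective zero    zero    _         _         eq   = refl , eq
replicate-++-injective zero    (suc c) (x<x ∷ _) _         refl = contradiction x<x (<-irrefl refl)
replicate-++-injective (suc b) zero    _         (x<x ∷ _) refl = contradiction x<x (<-irrefl refl)
replicate-++-injective (suc b) (suc c) xs<x      ys<x      eq
  with refl , refl ← replicate-++-injective b c xs<x ys<x (proj₂ (∷-injective eq)) = refl , refl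

-- Of the `N` available copies of `x`, `N ∸ k` become parts and the other `k` are passed on to the
-- smaller parts.
∸-*-+ : ∀ {k N} x V → k ≤ N → (N ∸ k) * x + (k * x + V) ≡ N * x + V
∸-*-+ {k} {N} x V k≤N = begin
  (N ∸ k) * x + (k * x + V)  ≡⟨ +-assoc ((N ∸ k) * x) (k * x) V ⟨
  (N ∸ k) * x + k * x + V    ≡⟨ cong (_+ V) (*-distribʳ-+ x (N ∸ k) k) ⟨
  (N ∸ k + k) * x + V        ≡⟨ cong (λ l → l * x + V) (m∸n+n≡m k≤N) ⟩
  N * x + V                  ∎
  where open ≡-Reasoning

prepend-maximum : ∀ {k N x V qs} → 0 < x → k ≤ N →
                  IsPartition (k * x + V) qs → All (_< x) qs →
                  IsPartition (N * x + V) (replicate (N ∸ k) x ++ qs)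
prepend-maximum {k} {N} {x} {V} {qs} 0<x k≤N qs-partition qs<x = record
  { decreasing = AllPairs⇒Linked (descending-replicate-++ (N ∸ k) (All.map <⇒≤ qs<x)
                   (Linked⇒AllPairs (flip ≤-trans) decreasing))
  ; positive   = All.++⁺ (All.replicate⁺ (N ∸ k) 0<x) positive
  ; total      = begin
      sum (replicate (N ∸ k) x ++ qs)     ≡⟨ sum-++ (replicate (N ∸ k) x) qs ⟩
      sum (replicate (N ∸ k) x) + sum qs  ≡⟨ cong₂ _+_ (sum-replicate (N ∸ k) x) total ⟩
      (N ∸ k) * x + (k * x + V)           ≡⟨ ∸-*-+ x V k≤N ⟩
      N * x + V                           ∎
  }
  where
  open IsPartition qs-partition
  open ≡-Reasoning

remove-maximum : ∀ {N x V ps} → V < x →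
                 IsPartition (N * x + V) ps → All (_≤ x) ps →
                 ∃[ k ] ∃[ qs ] k ≤ N × ps ≡ replicate (N ∸ k) x ++ qs
                   × IsPartition (k * x + V) qs × All (_< x) qs
remove-maximum {N} {x} {V} V<x ps-partition ps≤x
  with c , qs , refl , qs↘ , qs<x ←
    split-maximum (Linked⇒AllPairs (flip ≤-trans) (IsPartition.decreasing ps-partition)) ps≤x
  = N ∸ c , qs , m∸n≤m N c ,
    cong (λ d → replicate d x ++ qs) (sym (m∸[m∸n]≡n c≤N)) ,
    record { decreasing = AllPairs⇒Linked qs↘
           ; positive   = All.++⁻ʳ (replicate c x) positive
           ; total      = qs-total } ,
    qs<x
  where
  open IsPartition ps-partition

  split-total : c * x + sum qs ≡ N * x + V
  split-total = trans (sym (trans (sum-++ (replicate c x) qs)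
                                  (cong (_+ sum qs) (sum-replicate c x)))) total

  c≤N : c ≤ N
  -- With more than `N` copies the parts equal to `x` alone would amount to at least `N * x + x`,
  -- which is above the total.
  c≤N = ≮⇒≥ λ N<c → <-irrefl (sym split-total) (begin-strict
    N * x + V         <⟨ +-monoʳ-< (N * x) V<x ⟩
    N * x + x         ≡⟨ +-comm (N * x) x ⟩
    suc N * x         ≤⟨ *-monoˡ-≤ x N<c ⟩
    c * x             ≤⟨ m≤m+n (c * x) (sum qs) ⟩
    c * x + sum qs    ∎)
    where open ≤-Reasoning

  qs-total : sum qs ≡ (N ∸ c) * x + V
  qs-total = +-cancelˡ-≡ (c * x) _ _ (begin
    c * x + sum qs                           ≡⟨ split-total ⟩
    N * x + V                                ≡⟨ ∸-*-+ x V (m∸n≤m N c) ⟨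
    (N ∸ (N ∸ c)) * x + ((N ∸ c) * x + V)    ≡⟨ cong (λ d → d * x + ((N ∸ c) * x + V)) (m∸[m∸n]≡n c≤N) ⟩
    c * x + ((N ∸ c) * x + V)                ∎)
    where open ≡-Reasoning

-- No power of `m` lies strictly between `m ^ t` and `m ^ suc t`. This converts the strict bound on
-- parts into the weak one that `remove-maximum` takes.
IsPowerOf-≤ : ∀ {m p} .{{_ : NonZero m}} t → IsPowerOf m p → p < m ^ suc t → p ≤ m ^ t
IsPowerOf-≤ {m} t (i , refl) m^i<m^1+t = ^-monoʳ-≤ m {i} {t} (s≤s⁻¹ (≰⇒> λ 1+t≤i →
  <⇒≱ m^i<m^1+t (^-monoʳ-≤ m {suc t} {i} 1+t≤i)))

-- Digits, carries and the count of bounded tuples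

module _ (m : ℕ) (α : ℕ → ℕ) where

  lowDigits : ℕ → ℕ
  lowDigits t = ∑[ i ≤ t ] (α i * m ^ i)

  -- The parts up to and including `m ^ t`. An entry `k` is not a multiplicity: it is the number of
  -- copies of its power left to smaller parts, and the multiplicity is the complement within the
  -- bound.
  partsBelow : (t K : ℕ) → Vec ℕ t → List ℕ
  partsBelow zero    K []       = replicate (α 0 + m * K) 1
  partsBelow (suc t) K (k ∷ ks) =
    replicate (α (suc t) + m * K ∸ k) (m ^ suc t) ++ partsBelow t k ks

  IsLowPartition : (t K : ℕ) → List ℕ → Set
  IsLowPartition t K ps =
    IsMAryPartition m (K * m ^ suc t + lowDigits t) ps × All (_< m ^ suc t) ps

  -- By induction, with digits at most `m ∸ 1`. It supplies the remainder condition `V < x` of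
  -- `remove-maximum`.
  lowDigits-< : ∀ t → 0 < m → (∀ i → i ≤ t → α i ≤ m ∸ 1) → lowDigits t < m ^ suc t
  lowDigits-< zero 0<m digits = begin-strict
    α 0 * 1 + 0  ≡⟨ trans (+-identityʳ _) (*-identityʳ (α 0)) ⟩
    α 0          ≤⟨ digits 0 z≤n ⟩
    m ∸ 1        <⟨ ∸-monoʳ-< z<s 0<m ⟩
    m            ≡⟨ *-identityʳ m ⟨
    m * 1        ∎
    where open ≤-Reasoning
  lowDigits-< (suc t) 0<m digits = begin-strict
    lowDigits (suc t)                         ≡⟨ ∑≤-suc t (λ i → α i * m ^ i) ⟩
    lowDigits t + α (suc t) * m ^ suc t       <⟨ +-monoˡ-< _ (lowDigits-< t 0<m
                                                   λ i i≤t → digits i (m≤n⇒m≤1+n i≤t)) ⟩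
    m ^ suc t + α (suc t) * m ^ suc t         ≤⟨ *-monoˡ-≤ (m ^ suc t)
                                                   (s≤s (digits (suc t) ≤-refl)) ⟩
    suc (m ∸ 1) * m ^ suc t                   ≡⟨ cong (_* m ^ suc t) (m+[n∸m]≡n 0<m) ⟩
    m * m ^ suc t                             ∎
    where open ≤-Reasoning

  -- Each of the `K` copies of `m ^ (2 + t)` is worth `m` copies of `m ^ suc t`, which join the
  -- digit `α (suc t)`: the origin of the bound in `InnerBounds`.
  carry : ∀ t K → K * m ^ (2 + t) + lowDigits (suc t)
                ≡ (α (suc t) + m * K) * m ^ suc t + lowDigits t
  carry t K = trans (cong (K * m ^ (2 + t) +_) (∑≤-suc t (λ i → α i * m ^ i)))
                    (rearrange K m (m ^ suc t) (lowDigits t) (α (suc t)))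
    where
    rearrange : ∀ K m x V a → K * (m * x) + (V + a * x) ≡ (a + m * K) * x + V
    rearrange = solve-∀

  carry-zero : ∀ K → K * m ^ 1 + lowDigits 0 ≡ α 0 + m * K
  carry-zero K = rearrange K m (α 0)
    where
    rearrange : ∀ K m a → K * (m * 1) + (a * 1 + 0) ≡ a + m * K
    rearrange = solve-∀

  -- Nothing is carried into the top position, so the outermost bound is the general one at `K`
  -- equal to 0.
  nestedSum≡innerSum : ∀ j → nestedSum m α j ≡ innerSum m α j 0
  nestedSum≡innerSum zero    = refl
  nestedSum≡innerSum (suc t) = cong (λ b → ∑≤ b (innerSum m α t))
    (sym (trans (cong (α (suc t) +_) (*-zeroʳ m)) (+-identityʳ _)))

  InnerBounds⇔Bounds : ∀ {j} (ks : Vec ℕ j) → InnerBounds m α 0 ks ⇔ Bounds m α ks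
  InnerBounds⇔Bounds []               = mk⇔ id id
  InnerBounds⇔Bounds {suc t} (k ∷ ks)
    rewrite *-zeroʳ m | +-identityʳ (α (suc t)) = mk⇔ id id

  NumberOf-InnerBounds : ∀ t K →
    NumberOf (λ (ks : Vec ℕ t) → InnerBounds m α K ks) (innerSum m α t K)
  NumberOf-InnerBounds zero    K =
    [ [] ] , [] ∷ [] , (λ { [] → mk⇔ (λ _ → tt) (λ _ → here refl) }) , refl
  -- `BoundedCons` and `InnerBounds` unfold to the same type only after the vector is matched as a
  -- cons.
  NumberOf-InnerBounds (suc t) K = NumberOf-⇔ (λ { (k ∷ ks) → mk⇔ id id })
    (NumberOf-BoundedCons (α (suc t) + m * K) (NumberOf-InnerBounds t))

  -- The correspondence between bounded tuples and partitions

  module _ (1<m : 1 < m) where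

    private
      instance
        m≢0 : NonZero m
        m≢0 = >-nonZero (<-trans z<s 1<m)

    partsBelow-isLowPartition : ∀ t K (ks : Vec ℕ t) → InnerBounds m α K ks →
                                IsLowPartition t K (partsBelow t K ks)
    partsBelow-isLowPartition zero K [] _ =
      (record
        { decreasing = AllPairs⇒Linked (subst (AllPairs _≥_) (++-identityʳ _)
                         (descending-replicate-++ (α 0 + m * K) [] []))
        ; positive   = All.replicate⁺ _ z<s
        ; total      = trans (sum-replicate (α 0 + m * K) 1)
                         (trans (*-identityʳ _) (sym (carry-zero K)))
        } , All.replicate⁺ _ (0 , refl)) ,
      All.replicate⁺ _ (subst (1 <_) (sym (*-identityʳ m)) 1<m)
    partsBelow-isLowPartition (suc t) K (k ∷ ks) (k≤ , bounds)
      with (qs-partition , qs-powers) , qs< ← partsBelow-isLowPartition t k ks bounds =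
      (subst (λ n → IsPartition n (partsBelow (suc t) K (k ∷ ks))) (sym (carry t K))
        (prepend-maximum (m^n>0 m (suc t)) k≤ qs-partition qs<) ,
       All.++⁺ (All.replicate⁺ _ (suc t , refl)) qs-powers) ,
      All.++⁺ (All.replicate⁺ _ m^1+t<m^2+t) (All.map (λ q< → <-trans q< m^1+t<m^2+t) qs<)
      where m^1+t<m^2+t = ^-monoʳ-< m 1<m {suc t} (n<1+n (suc t))

    partsBelow-injective : ∀ t K {ks ls : Vec ℕ t} →
                           InnerBounds m α K ks → InnerBounds m α K ls →
                           partsBelow t K ks ≡ partsBelow t K ls → ks ≡ ls
    partsBelow-injective zero    K {[]}     {[]}     _            _            _  = refl
    partsBelow-injective (suc t) K {k ∷ ks} {l ∷ ls} (k≤ , kbnds) (l≤ , lbnds) eq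
      with counts≡ , rests≡ ← replicate-++-injective _ _
             (proj₂ (partsBelow-isLowPartition t k ks kbnds))
             (proj₂ (partsBelow-isLowPartition t l ls lbnds)) eq
      -- Equal multiplicities give equal entries because both entries are within the bound, where
      -- truncated subtraction loses nothing.
      with refl ← ∸-cancelˡ-≡ k≤ l≤ counts≡
      = cong (k ∷_) (partsBelow-injective t k kbnds lbnds rests≡)

    -- The tuple is read off from the largest power downwards: removing the copies of `m ^ suc t`
    -- yields `k` and leaves a low partition with carry `k`.
    partsBelow-surjective : ∀ t K {ps} → (∀ i → i ≤ t → α i ≤ m ∸ 1) →
                            IsLowPartition t K ps →
                            ∃[ ks ] InnerBounds m α K ks × partsBelow t K ks ≡ ps
    partsBelow-surjective zero K {ps} digits ((ps-partition , ps-powers) , ps<) =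
      [] , tt , sym (trans (all-1⇒replicate ps≡1)
        (cong (λ n → replicate n 1) (trans total (carry-zero K))))
      where
      open IsPartition ps-partition
      ps≡1 : All (_≡ 1) ps
      -- A power of `m` below `m ^ 1` is at most `m ^ 0`, and positivity leaves only 1.
      ps≡1 = All.zipWith (λ { (0<p , p-power , p<) → ≤-antisym (IsPowerOf-≤ 0 p-power p<) 0<p })
        (positive , All.zip (ps-powers , ps<))
    partsBelow-surjective (suc t) K {ps} digits ((ps-partition , ps-powers) , ps<)
      with k , qs , k≤ , refl , qs-partition , qs< ←
        remove-maximum {N = α (suc t) + m * K} {ps = ps}
          (lowDigits-< t (<-trans z<s 1<m) λ i i≤t → digits i (m≤n⇒m≤1+n i≤t))
          (subst (λ n → IsPartition n ps) (carry t K) ps-partition)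
          (All.zipWith (λ { (p-power , p<) → IsPowerOf-≤ (suc t) p-power p< }) (ps-powers , ps<))
      with ks , bounds , refl ← partsBelow-surjective t k
        (λ i i≤t → digits i (m≤n⇒m≤1+n i≤t))
        ((qs-partition , All.++⁻ʳ (replicate (α (suc t) + m * K ∸ k) _) ps-powers) , qs<)
      = k ∷ ks , (k≤ , bounds) , refl

-- Transfer of the count from tuples to partitions

theorem1p2 : (m n j : ℕ) (α : ℕ → ℕ) →
    2 ≤ m → 0 < n →
    m ^ j ≤ n → n < m ^ suc j →
    IsBaseRepresentation m j α n →
    NumberOf (IsMAryPartition m n) (nestedSum m α j)
    × NumberOf (λ (ks : Vec ℕ j) → Bounds m α ks) (nestedSum m α j)
    × (j ≡ 0 → NumberOf (IsMAryPartition m n) 1)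
-- For `j` equal to 0 the nested sum computes to 1, so the general count is already the last claim.
theorem1p2 m n j α 1<m _ _ n<m^1+j rep = partitions , tuples , λ { refl → partitions }
  where
  open IsBaseRepresentation rep

  inner : NumberOf (λ (ks : Vec ℕ j) → InnerBounds m α 0 ks) (nestedSum m α j)
  inner = subst (NumberOf _) (sym (nestedSum≡innerSum m α j)) (NumberOf-InnerBounds m α j 0)

  tuples : NumberOf (λ (ks : Vec ℕ j) → Bounds m α ks) (nestedSum m α j)
  tuples = NumberOf-⇔ (InnerBounds⇔Bounds m α) inner

  sound : ∀ {ps} → ∃[ ks ] InnerBounds m α 0 ks × partsBelow m α j 0 ks ≡ ps →
          IsMAryPartition m n ps
  sound (ks , bounds , refl) = subst (λ n → IsMAryPartition m n _) (sym value)
    (proj₁ (partsBelow-isLowPartition m α 1<m j 0 ks bounds))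

  complete : ∀ {ps} → IsMAryPartition m n ps →
             ∃[ ks ] InnerBounds m α 0 ks × partsBelow m α j 0 ks ≡ ps
  complete {ps} ps-mary = partsBelow-surjective m α 1<m j 0 digits
    (subst (λ n → IsMAryPartition m n ps) value ps-mary ,
     -- A part is at most the total `n`, hence below `m ^ suc j`; so every `m`-ary partition of `n`
     -- is a low partition with carry 0.
     All.map (λ p≤ → ≤-<-trans p≤ (subst (_< m ^ suc j)
       (sym (IsPartition.total (proj₁ ps-mary))) n<m^1+j)) (All-≤-sum ps))

  partitions : NumberOf (IsMAryPartition m n) (nestedSum m α j)
  partitions = NumberOf-⇔ (λ ps → mk⇔ sound complete)
    (NumberOf-image (partsBelow m α j 0) (partsBelow-injective m α 1<m j 0) inner)
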